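{- Let $D$ be a loopless graph on $n$ vertices. Then $\mathrm{s}_+[D^\circ, 2] = n-1$ if and only if $D$ is a non-empty near-biclique.
   Context: Graphs are finite and directed: $D=(V,E)$ with $V=\{1,\dots,n\}$, $n\ge1$, $E\subseteq V^2$. $D$ is loopless if it has no arc $(v,v)$; $D$ is non-empty if it has at least one arc. For loopless $D$, $D^\circ$ is obtained from $D$ by adding a loop on every vertex. $N(v)=\{u:(u,v)\in E\}$ is the in-neighbourhood of $v$ in $D$; a source of $D$ is a vertex $v$ with $N(v)=\emptyset$. A loopless graph $D$ is a near-biclique if its vertex set can be partitioned as $V=A\cup B\cup S$ (parts are allowed to be empty), where $S$ is the set of sources of $D$, and 1. for all distinct $a_1,a_2\in A$, $(a_1,a_2)\in E$ or $(a_2,a_1)\in E$ (or both); 2. for all distinct $b_1,b_2\in B$, $(b_1,b_2)\in E$ or $(b_2,b_1)\in E$ (or both); 3. for any $u,v\in V\setminus S$, there exists $w\in (N(u)\cup\{u\})\cap(N(v)\cup\{v\})$; 4. for any $a\in A$ and $b\in B$, there exists $w\in N(a)\cap N(b)$. Let $[2]=\{0,1\}$. For $f=(f_1,\dots,f_n):[2]^n\to[2]^n$, the interaction graph $G(f)$ has vertex set $V$ and an arc $(u,v)$ if and only if there exist $x,y\in[2]^n$ differing only in coordinate $u$ with $f_v(x)\ne f_v(y)$. $\mathrm{F}_+[H,2]$ is the set of all $f:[2]^n\to[2]^n$ with $G(f)=H$ that are monotone, i.e. $x\le y$ coordinatewise implies $f(x)\le f(y)$ coordinatewise. With $d_{\mathrm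 H}$ the Hamming distance, $\mathrm{s}(f)=\min_{x\in[2]^n}(n-d_{\mathrm H}(x,f(x)))$ and $\mathrm{s}_+[H,2]=\max_{f\in\mathrm{F}_+[H,2]}\mathrm{s}(f)$. -}

module Defs where

open import Level using (0ℓ)
open import Data.Bool.Base using (Bool; true; false)
import Data.Bool.Base as Bool
import Data.Bool.Properties as Bool
open import Data.Fin.Base using (Fin)
import Data.Fin.Properties as Fin
open import Data.Fin.Subset using (Subset; _∈_; _∉_; _∪_; _∩_; ⁅_⁆; ⊤; Empty; Nonempty)
open import Data.Nat.Base using (ℕ; zero; suc; _∸_; _⊓_; _≤_)
open import Data.Product using (_×_; _,_; ∃; ∃-syntax; ∃₂)
open import Data.Sum using (_⊎_)
open import Data.Vec.Base using (Vec; []; _∷_; lookup; tabulate; zip; count)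
open import Data.Vec.Relation.Binary.Pointwise.Inductive using (Pointwise)
open import Function.Bundles using (_⇔_)
open import Relation.Binary.Core using (Rel; _Preserves_⟶_)
open import Relation.Binary.Definitions using (Decidable)
open import Relation.Binary.PropositionalEquality using (_≡_; _≢_)
open import Relation.Nullary.Decidable using (does; ¬?; _⊎-dec_)
open import Relation.Nullary.Negation using (¬_)
open import Relation.Unary using (Pred)

record Digraph (n : ℕ) : Set₁ where
  field
    Arc  : Rel (Fin n) 0ℓ
    arc? : Decidable Arc

open Digraph public

Loopless : ∀ {n} → Digraph n → Set
Loopless D = ∀ v → ¬ Arc D v v

HasArc : ∀ {n} → Digraph n → Set
HasArc D = ∃₂ (Arc D)

infix 25 _°
_° : ∀ {n} → Digraph n → Digraph n
Arc  (D °) u v = Arc D u v ⊎ u ≡ v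
arc? (D °) u v = arc? D u v ⊎-dec u Fin.≟ v

N : ∀ {n} → Digraph n → Fin n → Subset n
N D v = tabulate (λ u → does (arc? D u v))

IsSource : ∀ {n} → Digraph n → Fin n → Set
IsSource D v = Empty (N D v)

record NearBiclique {n : ℕ} (D : Digraph n) : Set where
  field
    A B S : Subset n

    cover        : A ∪ B ∪ S ≡ ⊤
    A∩B-disjoint : Empty (A ∩ B)
    A∩S-disjoint : Empty (A ∩ S)
    B∩S-disjoint : Empty (B ∩ S)

    S-sources : ∀ v → v ∈ S ⇔ IsSource D v

    A-semicomplete : ∀ a₁ a₂ → a₁ ∈ A → a₂ ∈ A → a₁ ≢ a₂ →
                     Arc D a₁ a₂ ⊎ Arc D a₂ a₁
    B-semicomplete : ∀ b₁ b₂ → b₁ ∈ B → b₂ ∈ B → b₁ ≢ b₂ →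
                     Arc D b₁ b₂ ⊎ Arc D b₂ b₁
    closed-meet    : ∀ u v → u ∉ S → v ∉ S →
                     Nonempty ((N D u ∪ ⁅ u ⁆) ∩ (N D v ∪ ⁅ v ⁆))
    A-B-meet       : ∀ a b → a ∈ A → b ∈ B → Nonempty (N D a ∩ N D b)

-- {0,1}ⁿ, with false for 0 and true for 1.
Config : ℕ → Set
Config n = Vec Bool n

-- The coordinatewise order.
_≤ᶜ_ : ∀ {n} → Rel (Config n) 0ℓ
_≤ᶜ_ = Pointwise Bool._≤_

DifferOnlyAt : ∀ {n} → Fin n → Rel (Config n) 0ℓ
DifferOnlyAt u x y =
  lookup x u ≢ lookup y u × (∀ w → w ≢ u → lookup x w ≡ lookup y w)

-- The arc relation of the interaction graph of f.
G : ∀ {n} → (Config n → Config n) → Rel (Fin n) 0ℓ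
G f u v = ∃₂ λ x y → DifferOnlyAt u x y × lookup (f x) v ≢ lookup (f y) v

-- The set F₊[H, 2]; equality of graphs is extensional equality of arc sets.
F₊ : ∀ {n} → Digraph n → Pred (Config n → Config n) 0ℓ
F₊ H f = (∀ u v → G f u v ⇔ Arc H u v) × f Preserves _≤ᶜ_ ⟶ _≤ᶜ_

hamming : ∀ {n} → Config n → Config n → ℕ
hamming x y = count (λ (a , b) → ¬? (a Bool.≟ b)) (zip x y)

-- The minimum of g over all of {0,1}ⁿ.
minimum : ∀ {n} → (Config n → ℕ) → ℕ
minimum {zero}  g = g []
minimum {suc n} g = minimum (λ x → g (false ∷ x)) ⊓ minimum (λ x → g (true ∷ x))

-- Truncated subtraction is harmless here: hamming x (f x) never exceeds n.
s : ∀ {n} → (Config n → Config n) → ℕ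
s {n} f = minimum (λ x → n ∸ hamming x (f x))

IsMaximum : {X : Set} → Pred X 0ℓ → (X → ℕ) → ℕ → Set
IsMaximum P g m = (∃[ x ] (P x × g x ≡ m)) × (∀ x → P x → g x ≤ m)

-- s₊[ H ]= m says that s₊[H, 2] is equal to m.
infix 4 s₊[_]=_
s₊[_]=_ : ∀ {n} → Digraph n → ℕ → Set
s₊[ H ]= m = IsMaximum (F₊ H) s m

{-# OPTIONS --safe #-}

-- Call v lowered by f if f_v(e_v) = 0 and raised by f if f_v(1 - e_v) = 1.
-- By monotonicity, a vertex that is neither lowered nor raised is fixed by f
-- everywhere, and these vertices are exactly the sources of D.
-- If u moves in a configuration c and v ≠ u moves in d, and c and d agree on
-- the common closed in-neighbours of u and v, then merging c and d yields a
-- configuration in which both move.  Hence, when at most one coordinate moves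
-- at a time, c and d differ at some common closed in-neighbour.  Taking c and
-- d among the e_v and 1 - e_v gives the conditions of a near-biclique, with A
-- the lowered vertices and B the raised ones that are not lowered.
-- Conversely, f_a(x) = x_a ∧ ⋁ x|N(a) on A, f_b(x) = x_b ∨ ⋀ x|N(b) on B and
-- f_s(x) = x_s on S define an f that moves at most one coordinate at a time.
module Submission where

open import Defs
open import Level using (Level; 0ℓ)
open import Data.Bool.Base using (Bool; true; false; if_then_else_; b≤b)
import Data.Bool.Base as Bool
import Data.Bool.Properties as Bool
open import Data.Fin.Base using (Fin; zero; suc)
import Data.Fin.Properties as Fin
open import Data.Fin.Subset using (Subset; _∈_; _∉_; _⊆_; _∪_; _∩_; ⁅_⁆; ⊤; ⊥; ∁; Nonempty)
open import Data.Fin.Subset.Properties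
open import Data.Nat.Base using (ℕ; zero; suc; NonZero; >-nonZero⁻¹; _∸_; _≤_; z≤n; s≤s)
import Data.Nat.Properties as ℕ
open import Data.Product using (_×_; _,_; ∃; ∃-syntax; proj₁; proj₂)
open import Data.Sum using (_⊎_; inj₁; inj₂; [_,_]′)
open import Data.Vec.Base using ([]; _∷_; here; lookup; tabulate; zip; _[_]≔_)
open import Data.Vec.Properties
  using ([]=⇒lookup; lookup⇒[]=; lookup∘tabulate; lookup∘update; lookup∘update′; []≔-lookup; count≤n)
open import Data.Vec.Relation.Binary.Pointwise.Inductive as Pointwise using ([]; _∷_)
open import Function.Base using (_∘_; id)
open import Function.Bundles using (_⇔_; mk⇔; Equivalence)
open import Relation.Binary.Definitions using (Reflexive)
open import Relation.Binary.PropositionalEquality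
open import Relation.Nullary.Decidable
  using (yes; no; does; ¬?; _×-dec_; _⊎-dec_; _→-dec_; decidable-stable; dec-true; dec-false)
open import Relation.Nullary.Negation using (¬_; contradiction)
open import Relation.Unary using (Pred; Decidable)

open Equivalence using (to; from)

private
  variable
    ℓ : Level
    n : ℕ

-- Configurations as sets of coordinates with value 1

∈-tabulate⁺ : {P : Pred (Fin n) ℓ} (P? : Decidable P) →
              ∀ {v} → P v → v ∈ tabulate (does ∘ P?)
∈-tabulate⁺ P? {v} p =
  lookup⇒[]= v _ (trans (lookup∘tabulate (does ∘ P?) v) (dec-true (P? v) p))

∈-tabulate⁻ : {P : Pred (Fin n) ℓ} (P? : Decidable P) →
              ∀ {v} → v ∈ tabulate (does ∘ P?) → P v
∈-tabulate⁻ P? {v} v∈ with P? v | trans (sym (lookup∘tabulate (does ∘ P?) v)) ([]=⇒lookup v∈)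
... | yes p | _  = p
... | no _  | ()

lookup-≡⁺ : ∀ {x y : Subset n} {v} → (v ∈ x → v ∈ y) → (v ∈ y → v ∈ x) → lookup x v ≡ lookup y v
lookup-≡⁺ {x = x} {y} {v} x→y y→x with lookup x v in xv | lookup y v in yv
... | true  | true  = refl
... | false | false = refl
... | true  | false = trans (sym ([]=⇒lookup (x→y (lookup⇒[]= v x xv)))) yv
... | false | true  = trans (sym xv) ([]=⇒lookup (y→x (lookup⇒[]= v y yv)))

∈-resp-lookup : ∀ {x y : Subset n} {v} → lookup x v ≡ lookup y v → v ∈ x → v ∈ y
∈-resp-lookup {y = y} {v} eq v∈x = lookup⇒[]= v y (trans (sym eq) ([]=⇒lookup v∈x))

lookup-≢⁺ : ∀ {x y : Subset n} {v} → v ∈ x → v ∉ y → lookup x v ≢ lookup y v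
lookup-≢⁺ v∈x v∉y eq = v∉y (∈-resp-lookup eq v∈x)

lookup-≢⁻ : ∀ {x y : Subset n} {v} → lookup x v ≢ lookup y v →
            (v ∈ x × v ∉ y) ⊎ (v ∉ x × v ∈ y)
lookup-≢⁻ {x = x} {y} {v} x≢y with v ∈? x | v ∈? y
... | yes v∈x | no v∉y  = inj₁ (v∈x , v∉y)
... | no v∉x  | yes v∈y = inj₂ (v∉x , v∈y)
... | yes v∈x | yes v∈y = contradiction (lookup-≡⁺ (λ _ → v∈y) (λ _ → v∈x)) x≢y
... | no v∉x  | no v∉y  =
  contradiction (lookup-≡⁺ (λ v∈x → contradiction v∈x v∉x) (λ v∈y → contradiction v∈y v∉y)) x≢y

-- `Config n` and `Subset n` unfold to the same type, so the coordinatewise order can be handled as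
-- inclusion.
⊆⇒≤ᶜ : ∀ {x y : Subset n} → x ⊆ y → x ≤ᶜ y
⊆⇒≤ᶜ {x = []}        {[]}        x⊆y = []
⊆⇒≤ᶜ {x = false ∷ x} {b ∷ y}     x⊆y = Bool.≤-minimum b ∷ ⊆⇒≤ᶜ (drop-∷-⊆ x⊆y)
⊆⇒≤ᶜ {x = true ∷ x}  {true ∷ y}  x⊆y = b≤b ∷ ⊆⇒≤ᶜ (drop-∷-⊆ x⊆y)
⊆⇒≤ᶜ {x = true ∷ x}  {false ∷ y} x⊆y with x⊆y here
... | ()

≤ᶜ⇒⊆ : ∀ {x y : Subset n} → x ≤ᶜ y → x ⊆ y
≤ᶜ⇒⊆ {y = y} x≤y {v} v∈x
  with lookup y v in yv | subst (Bool._≤ lookup y v) ([]=⇒lookup v∈x) (Pointwise.lookup x≤y v)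
... | true | _ = lookup⇒[]= v y yv

x∈∁⁅y⁆⁺ : ∀ {x y : Fin n} → x ≢ y → x ∈ ∁ ⁅ y ⁆
x∈∁⁅y⁆⁺ {y = y} x≢y = x∉p⇒x∈∁p (x≢y ∘ x∈⁅y⁆⇒x≡y y)

x∈∁⁅y⁆⁻ : ∀ {x y : Fin n} → x ∈ ∁ ⁅ y ⁆ → x ≢ y
x∈∁⁅y⁆⁻ x∈ refl = x∈∁p⇒x∉p x∈ (x∈⁅x⁆ _)

-- Configurations and Hamming distance

minimum-≤ : ∀ (g : Config n → ℕ) x → minimum g ≤ g x
minimum-≤ g []          = ℕ.≤-refl
minimum-≤ g (false ∷ x) = ℕ.≤-trans (ℕ.m⊓n≤m _ _) (minimum-≤ (g ∘ (false ∷_)) x)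
minimum-≤ g (true ∷ x)  = ℕ.≤-trans (ℕ.m⊓n≤n _ _) (minimum-≤ (g ∘ (true ∷_)) x)

minimum-glb : ∀ (g : Config n → ℕ) {m} → (∀ x → m ≤ g x) → m ≤ minimum g
minimum-glb {zero}  g m≤g = m≤g []
minimum-glb {suc n} g m≤g =
  ℕ.⊓-glb (minimum-glb _ (m≤g ∘ (false ∷_))) (minimum-glb _ (m≤g ∘ (true ∷_)))

hamming≤n : (x y : Config n) → hamming x y ≤ n
hamming≤n x y = count≤n _ (zip x y)

hamming≡0 : (x y : Config n) → (∀ v → lookup x v ≡ lookup y v) → hamming x y ≡ 0
hamming≡0 []      []      _  = refl
hamming≡0 (a ∷ x) (b ∷ y) eq with a Bool.≟ b
... | yes _  = hamming≡0 x y (eq ∘ suc)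
... | no a≢b = contradiction (eq zero) a≢b

hamming≥1 : (x y : Config n) → ∀ v → lookup x v ≢ lookup y v → 1 ≤ hamming x y
hamming≥1 (a ∷ x) (b ∷ y) v ne with a Bool.≟ b
hamming≥1 (a ∷ x) (b ∷ y) v       ne | no _    = s≤s z≤n
hamming≥1 (a ∷ x) (b ∷ y) zero    ne | yes a≡b = contradiction a≡b ne
hamming≥1 (a ∷ x) (b ∷ y) (suc v) ne | yes _   = hamming≥1 x y v ne

hamming≥2 : (x y : Config n) → ∀ u v → u ≢ v →
            lookup x u ≢ lookup y u → lookup x v ≢ lookup y v → 2 ≤ hamming x y
hamming≥2 (a ∷ x) (b ∷ y) u v u≢v xu≢yu xv≢yv with a Bool.≟ b
hamming≥2 (a ∷ x) (b ∷ y) zero    v       u≢v xu≢yu xv≢yv | yes a≡b = contradiction a≡b xu≢yu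
hamming≥2 (a ∷ x) (b ∷ y) (suc u) zero    u≢v xu≢yu xv≢yv | yes a≡b = contradiction a≡b xv≢yv
hamming≥2 (a ∷ x) (b ∷ y) (suc u) (suc v) u≢v xu≢yu xv≢yv | yes _   =
  hamming≥2 x y u v (u≢v ∘ cong suc) xu≢yu xv≢yv
hamming≥2 (a ∷ x) (b ∷ y) zero    zero    u≢v xu≢yu xv≢yv | no _    = contradiction refl u≢v
hamming≥2 (a ∷ x) (b ∷ y) zero    (suc v) u≢v xu≢yu xv≢yv | no _    = s≤s (hamming≥1 x y v xv≢yv)
hamming≥2 (a ∷ x) (b ∷ y) (suc u) v       u≢v xu≢yu xv≢yv | no _    = s≤s (hamming≥1 x y u xu≢yu)

hamming≤1 : (x y : Config n) →
            (∀ u v → lookup x u ≢ lookup y u → lookup x v ≢ lookup y v → u ≡ v) →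
            hamming x y ≤ 1
hamming≤1 []      []      _      = z≤n
hamming≤1 (a ∷ x) (b ∷ y) unique with a Bool.≟ b
... | yes _  = hamming≤1 x y λ u v p q → Fin.suc-injective (unique (suc u) (suc v) p q)
... | no a≢b = s≤s (ℕ.≤-reflexive (hamming≡0 x y λ v →
  decidable-stable (_ Bool.≟ _) λ p → Fin.0≢1+n (unique zero (suc v) a≢b p)))

Moves : (Config n → Config n) → Config n → Fin n → Set
Moves f x v = lookup x v ≢ lookup (f x) v

AtMostOneMoves : (Config n → Config n) → Set
AtMostOneMoves f = ∀ x u v → Moves f x u → Moves f x v → u ≡ v

n∸1≤s⁺ : (f : Config n → Config n) → AtMostOneMoves f → n ∸ 1 ≤ s f
n∸1≤s⁺ {n} f unique =
  minimum-glb _ λ x → ℕ.∸-monoʳ-≤ n (hamming≤1 x (f x) (unique x))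

n∸1≤s⁻ : (f : Config n → Config n) → n ∸ 1 ≤ s f → AtMostOneMoves f
n∸1≤s⁻ {n} f n∸1≤s x u v p q = decidable-stable (u Fin.≟ v) λ u≢v →
  -- Subtraction truncates; `hamming≤n` is what makes it strictly decreasing here.
  ℕ.<⇒≱ (ℕ.∸-monoʳ-< (hamming≥2 x (f x) u v u≢v p q) (hamming≤n x (f x)))
        (ℕ.≤-trans n∸1≤s (minimum-≤ _ x))

n≤s⁺ : (f : Config n → Config n) → (∀ x v → lookup x v ≡ lookup (f x) v) → n ≤ s f
n≤s⁺ {n} f fixed =
  minimum-glb _ λ x → ℕ.≤-reflexive (cong (n ∸_) (sym (hamming≡0 x (f x) (fixed x))))

s≤n∸1⁺ : (f : Config n → Config n) → ∀ {x v} → Moves f x v → s f ≤ n ∸ 1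
s≤n∸1⁺ {n} f {x} {v} p =
  ℕ.≤-trans (minimum-≤ _ x) (ℕ.∸-monoʳ-≤ n (hamming≥1 x (f x) v p))

-- Interaction graphs

∈N⁺ : ∀ (D : Digraph n) {u v} → Arc D u v → u ∈ N D v
∈N⁺ D {v = v} = ∈-tabulate⁺ (λ u → arc? D u v)

∈N⁻ : ∀ (D : Digraph n) {u v} → u ∈ N D v → Arc D u v
∈N⁻ D {v = v} = ∈-tabulate⁻ (λ u → arc? D u v)

-- Go from `x` to `y` by changing, one at a time, the coordinates where they differ. The
-- intermediate configurations mix the two, so invariance is asked at every `z`.
update-invariant : (g : Config n → Bool) (x y : Config n) →
                   (∀ u → lookup x u ≢ lookup y u → ∀ z b → g (z [ u ]≔ b) ≡ g z) →
                   g x ≡ g y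
update-invariant g []      []      _   = refl
update-invariant g (a ∷ x) (b ∷ y) inv =
  trans (update-invariant (g ∘ (a ∷_)) x y λ u ne z → inv (suc u) ne (a ∷ z)) a∷y~b∷y
  where
  a∷y~b∷y : g (a ∷ y) ≡ g (b ∷ y)
  a∷y~b∷y with a Bool.≟ b
  ... | yes refl = refl
  ... | no a≢b   = inv zero a≢b (b ∷ y) a

lookup-cong-G : ∀ {f : Config n → Config n} {v x y} →
                (∀ u → lookup x u ≢ lookup y u → ¬ G f u v) →
                lookup (f x) v ≡ lookup (f y) v
lookup-cong-G {f = f} {v} {x} {y} noArc =
  update-invariant (λ z → lookup (f z) v) x y λ u xu≢yu z b →
    decidable-stable (_ Bool.≟ _) λ ne → noArc u xu≢yu
      ( z [ u ]≔ b , z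
      , ( (λ eq → ne (cong (λ z → lookup (f z) v) (unchanged u z b eq)))
        , λ w w≢u → lookup∘update′ w≢u z b )
      , ne )
  where
  unchanged : ∀ u z b → lookup (z [ u ]≔ b) u ≡ lookup z u → z [ u ]≔ b ≡ z
  unchanged u z b eq =
    trans (cong (z [ u ]≔_) (trans (sym (lookup∘update u z b)) eq)) ([]≔-lookup z u)

module Realisation (H : Digraph n) {f : Config n → Config n} (f∈F₊ : F₊ H f) where

  f-mono : ∀ {x y} → x ⊆ y → f x ⊆ f y
  f-mono x⊆y = ≤ᶜ⇒⊆ (proj₂ f∈F₊ (⊆⇒≤ᶜ x⊆y))

  lookup-cong : ∀ {v x y} → (∀ u → Arc H u v → lookup x u ≡ lookup y u) →
                lookup (f x) v ≡ lookup (f y) v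
  lookup-cong agree =
    lookup-cong-G {f = f} λ u xu≢yu Guv → xu≢yu (agree u (to (proj₁ f∈F₊ u _) Guv))

  -- The union `x ∪ y` lies above `x`, so monotonicity applies, and it agrees with `y` at every
  -- in-neighbour of `v`.
  local-mono : ∀ {v x y} → (∀ u → Arc H u v → u ∈ x → u ∈ y) → v ∈ f x → v ∈ f y
  local-mono {v} {x} {y} x→y v∈fx =
    ∈-resp-lookup
      (lookup-cong λ u uv → lookup-≡⁺ (λ u∈ → [ x→y u uv , id ]′ (x∈p∪q⁻ x y u∈)) (q⊆p∪q x y))
      (f-mono (p⊆p∪q y) v∈fx)

  move-apart : Reflexive (Arc H) → AtMostOneMoves f →
               ∀ {u v} c d → u ≢ v → Moves f c u → Moves f d v →
               ∃[ w ] (Arc H w u × Arc H w v × lookup c w ≢ lookup d w)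
  move-apart H-refl unique {u} {v} c d u≢v cu dv =
    decidable-stable
      (Fin.any? λ w → arc? H w u ×-dec arc? H w v ×-dec ¬? (lookup c w Bool.≟ lookup d w))
      λ none → u≢v (unique e u v (moves e~c cu) (moves (e~d none) dv))
    where
    -- The merge gives priority to `c`: `u` sees exactly `c`, while `v` sees `d` as soon as `c` and
    -- `d` agree on the common in-neighbours.
    entry : Fin _ → Bool
    entry w = if does (arc? H w u) then lookup c w else lookup d w

    e : Config _
    e = tabulate entry

    e~c : ∀ w → Arc H w u → lookup e w ≡ lookup c w
    e~c w wu = trans (lookup∘tabulate entry w)
      (cong (if_then lookup c w else lookup d w) (dec-true (arc? H w u) wu))

    e~d : ¬ (∃[ w ] (Arc H w u × Arc H w v × lookup c w ≢ lookup d w)) →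
          ∀ w → Arc H w v → lookup e w ≡ lookup d w
    e~d none w wv with arc? H w u
    ... | yes wu = trans (e~c w wu)
                     (decidable-stable (_ Bool.≟ _) λ ne → none (w , wu , wv , ne))
    ... | no ¬wu = trans (lookup∘tabulate entry w)
                     (cong (if_then lookup c w else lookup d w) (dec-false (arc? H w u) ¬wu))

    moves : ∀ {w c′} → (∀ t → Arc H t w → lookup e t ≡ lookup c′ t) → Moves f c′ w → Moves f e w
    moves agree c′w eq =
      -- Reflexivity puts `w` among its own in-neighbours, so `e` and `c′` agree at `w` itself as
      -- well as in their images there.
      c′w (trans (sym (agree _ H-refl)) (trans eq (lookup-cong agree)))

-- From an update function to a near-biclique

module Necessity {D : Digraph n} (loopless : Loopless D) {f : Config n → Config n}
                 (f∈F₊ : F₊ (D °) f) where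
  open Realisation (D °) f∈F₊

  -- `⁅ v ⁆` is the least configuration with value 1 at `v`, and `∁ ⁅ v ⁆` the greatest with value
  -- 0. A monotone `f` that moves `v` down anywhere does so at the first; one that moves it up
  -- anywhere does so at the second.
  Lowered Raised : Pred (Fin n) 0ℓ
  Lowered v = v ∉ f ⁅ v ⁆
  Raised  v = v ∈ f (∁ ⁅ v ⁆)

  lowered? : Decidable Lowered
  lowered? v = ¬? (v ∈? f ⁅ v ⁆)

  raised? : Decidable Raised
  raised? v = v ∈? f (∁ ⁅ v ⁆)

  fixed : ∀ {v} → ¬ Lowered v → ¬ Raised v → ∀ x → lookup x v ≡ lookup (f x) v
  fixed {v} ¬low ¬high x = lookup-≡⁺
    (λ v∈x → f-mono (λ w∈ → subst (_∈ x) (sym (x∈⁅y⁆⇒x≡y v w∈)) v∈x)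
                         (decidable-stable (v ∈? f ⁅ v ⁆) ¬low))
    (λ v∈fx → decidable-stable (v ∈? x) λ v∉x →
      ¬high (f-mono (λ w∈x → x∈∁⁅y⁆⁺ λ { refl → v∉x w∈x }) v∈fx))

  source⇒loop : ∀ {v w} → IsSource D v → Arc (D °) w v → w ≡ v
  source⇒loop {w = w} source = [ (λ wv → contradiction (w , ∈N⁺ D wv) source) , id ]′

  -- The loop at `v` in `D °` makes the output at `v` depend on coordinate `v`.
  nonconstant : ∀ {v} → ¬ (∀ x y → lookup (f x) v ≡ lookup (f y) v)
  nonconstant {v} constant with from (proj₁ f∈F₊ v v) (inj₂ refl)
  ... | x , y , _ , ne = ne (constant x y)

  -- In `D °` a source has only itself as in-neighbour, so its output is a monotone function of its
  -- own value. If it were 0 on the value 1, it would be constantly 0.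
  source⇒¬lowered : ∀ {v} → IsSource D v → ¬ Lowered v
  source⇒¬lowered {v} source low = nonconstant λ x y →
    lookup-≡⁺ (λ v∈ → contradiction v∈ (never x)) (λ v∈ → contradiction v∈ (never y))
    where
    never : ∀ x → v ∉ f x
    never x v∈fx = low (local-mono
      (λ w wv _ → subst (_∈ ⁅ v ⁆) (sym (source⇒loop source wv)) (x∈⁅x⁆ v)) v∈fx)

  source⇒¬raised : ∀ {v} → IsSource D v → ¬ Raised v
  source⇒¬raised {v} source high = nonconstant λ x y →
    lookup-≡⁺ (λ _ → always y) (λ _ → always x)
    where
    always : ∀ x → v ∈ f x
    always x = local-mono
      (λ w wv w∈ → contradiction (source⇒loop source wv) (x∈∁⁅y⁆⁻ w∈)) high

  fixed⇒source : ∀ {v} → (∀ x → lookup x v ≡ lookup (f x) v) → IsSource D v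
  fixed⇒source {v} fix (u , u∈N) with from (proj₁ f∈F₊ u v) (inj₁ (∈N⁻ D u∈N))
  ... | x , y , (_ , agree) , ne =
    -- Looplessness gives `v ≢ u`, so `x` and `y` agree at `v`, and fixedness carries this over to
    -- the outputs.
    ne (trans (sym (fix x)) (trans (agree v λ { refl → loopless u (∈N⁻ D u∈N) }) (fix y)))

  lowered⇒moves : ∀ {v} → Lowered v → Moves f ⁅ v ⁆ v
  lowered⇒moves {v} low = lookup-≢⁺ (x∈⁅x⁆ v) low

  raised⇒moves : ∀ {v} → Raised v → Moves f (∁ ⁅ v ⁆) v
  raised⇒moves high eq = x∈∁⁅y⁆⁻ (∈-resp-lookup (sym eq) high) refl

  -- Without arcs every vertex is a source, hence fixed, so `s f` reaches `n`, which exceeds `n ∸ 1`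
  -- because `n` is nonzero.
  hasArc : .{{_ : NonZero n}} → s f ≡ n ∸ 1 → HasArc D
  hasArc s≡ = decidable-stable (Fin.any? λ u → Fin.any? (arc? D u)) λ none →
    let source : ∀ v → IsSource D v
        source v (u , u∈N) = none (u , v , ∈N⁻ D u∈N)
    in ℕ.<-irrefl (sym s≡) (ℕ.<-≤-trans (ℕ.∸-monoʳ-< {n} (s≤s z≤n) (>-nonZero⁻¹ n))
         (n≤s⁺ f λ x v → fixed (source⇒¬lowered (source v)) (source⇒¬raised (source v)) x))

  module _ (unique : AtMostOneMoves f) where

    apart : ∀ {u v} c d → u ≢ v → Moves f c u → Moves f d v →
            ∃[ w ] (Arc (D °) w u × Arc (D °) w v × lookup c w ≢ lookup d w)
    apart = move-apart (inj₂ refl) unique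

    -- Only one of the two arcs leaving `w` can be a loop; the other joins `u` and `v` in `D`.
    common⇒arc : ∀ {u v w} → u ≢ v → w ≡ u ⊎ w ≡ v → Arc (D °) w u → Arc (D °) w v →
                 Arc D u v ⊎ Arc D v u
    common⇒arc u≢v (inj₁ refl) _         (inj₁ uv)   = inj₁ uv
    common⇒arc u≢v (inj₁ refl) _         (inj₂ u≡v)  = contradiction u≡v u≢v
    common⇒arc u≢v (inj₂ refl) (inj₁ vu) _           = inj₂ vu
    common⇒arc u≢v (inj₂ refl) (inj₂ v≡u) _          = contradiction (sym v≡u) u≢v

    -- `⁅ u ⁆` and `⁅ v ⁆` differ only at `u` and `v`, so the common in-neighbour at which they
    -- differ is one of these. Their complements serve the raised case in the same way.
    lowered-semicomplete : ∀ {u v} → Lowered u → Lowered v → u ≢ v → Arc D u v ⊎ Arc D v u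
    lowered-semicomplete {u} {v} lu lv u≢v
      with apart ⁅ u ⁆ ⁅ v ⁆ u≢v (lowered⇒moves lu) (lowered⇒moves lv)
    ... | w , wu , wv , ne with lookup-≢⁻ ne
    ...   | inj₁ (w∈ , _) = common⇒arc u≢v (inj₁ (x∈⁅y⁆⇒x≡y u w∈)) wu wv
    ...   | inj₂ (_ , w∈) = common⇒arc u≢v (inj₂ (x∈⁅y⁆⇒x≡y v w∈)) wu wv

    raised-semicomplete : ∀ {u v} → Raised u → Raised v → u ≢ v → Arc D u v ⊎ Arc D v u
    raised-semicomplete {u} {v} ru rv u≢v
      with apart (∁ ⁅ u ⁆) (∁ ⁅ v ⁆) u≢v (raised⇒moves ru) (raised⇒moves rv)
    ... | w , wu , wv , ne with lookup-≢⁻ ne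
    ...   | inj₁ (_ , w∉) = common⇒arc u≢v (inj₂ (x∈⁅y⁆⇒x≡y v (x∉∁p⇒x∈p w∉))) wu wv
    ...   | inj₂ (w∉ , _) = common⇒arc u≢v (inj₁ (x∈⁅y⁆⇒x≡y u (x∉∁p⇒x∈p w∉))) wu wv

    -- `⁅ u ⁆` and `∁ ⁅ v ⁆` are both 1 at `u` and both 0 at `v`. The vertex at which they differ is
    -- therefore neither, and its arcs to `u` and `v` are not loops.
    lowered-raised-meet : ∀ {u v} → u ≢ v → Lowered u → Raised v → Nonempty (N D u ∩ N D v)
    lowered-raised-meet {u} {v} u≢v lu rv
      with apart ⁅ u ⁆ (∁ ⁅ v ⁆) u≢v (lowered⇒moves lu) (raised⇒moves rv)
    ... | w , inj₁ wu , inj₁ wv , _  = w , x∈p∩q⁺ (∈N⁺ D wu , ∈N⁺ D wv)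
    ... | w , inj₂ refl , _ , ne     =
      contradiction (lookup-≡⁺ (λ _ → x∈∁⁅y⁆⁺ u≢v) (λ _ → x∈⁅x⁆ u)) ne
    ... | w , inj₁ _ , inj₂ refl , ne = contradiction
      (lookup-≡⁺ (λ v∈ → contradiction (sym (x∈⁅y⁆⇒x≡y u v∈)) u≢v)
                 (λ v∈ → contradiction refl (x∈∁⁅y⁆⁻ v∈))) ne

    moving-meet : ∀ {u v} → ∃ (λ c → Moves f c u) → ∃ (λ d → Moves f d v) →
                  Nonempty ((N D u ∪ ⁅ u ⁆) ∩ (N D v ∪ ⁅ v ⁆))
    moving-meet {u} {v} (c , cu) (d , dv) with u Fin.≟ v
    ... | yes refl = u , x∈p∩q⁺ (q⊆p∪q (N D u) _ (x∈⁅x⁆ u) , q⊆p∪q (N D u) _ (x∈⁅x⁆ u))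
    ... | no u≢v   with apart c d u≢v cu dv
    ...   | w , wu , wv , _ = w , x∈p∩q⁺ (closed wu , closed wv)
      where
      closed : ∀ {v} → Arc (D °) w v → w ∈ N D v ∪ ⁅ v ⁆
      closed (inj₁ wv)   = p⊆p∪q _ (∈N⁺ D wv)
      closed (inj₂ refl) = q⊆p∪q (N D w) _ (x∈⁅x⁆ w)

    onlyRaised? : Decidable (λ v → ¬ Lowered v × Raised v)
    onlyRaised? v = ¬? (lowered? v) ×-dec raised? v

    fixed? : Decidable (λ v → ¬ Lowered v × ¬ Raised v)
    fixed? v = ¬? (lowered? v) ×-dec ¬? (raised? v)

    nearBiclique : NearBiclique D
    nearBiclique = record
      { A = A ; B = B ; S = S
      ; cover          = ⊆-antisym ⊆⊤ λ {v} _ → x∈p∪q⁺ (covered v)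
      ; A∩B-disjoint   = λ (v , v∈) → let (a , b) = x∈p∩q⁻ A B v∈ in proj₁ (∈B⁻ b) (∈A⁻ a)
      ; A∩S-disjoint   = λ (v , v∈) → let (a , s) = x∈p∩q⁻ A S v∈ in proj₁ (∈S⁻ s) (∈A⁻ a)
      ; B∩S-disjoint   = λ (v , v∈) →
          let (b , s) = x∈p∩q⁻ B S v∈ in proj₂ (∈S⁻ s) (proj₂ (∈B⁻ b))
      ; S-sources      = λ v → mk⇔
          (λ v∈S → let (¬low , ¬high) = ∈S⁻ v∈S in fixed⇒source (fixed ¬low ¬high))
          (λ source → ∈-tabulate⁺ fixed? (source⇒¬lowered source , source⇒¬raised source))
      ; A-semicomplete = λ _ _ a₁ a₂ → lowered-semicomplete (∈A⁻ a₁) (∈A⁻ a₂)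
      ; B-semicomplete = λ _ _ b₁ b₂ → raised-semicomplete (proj₂ (∈B⁻ b₁)) (proj₂ (∈B⁻ b₂))
      ; closed-meet    = λ _ _ u∉S v∉S → moving-meet (moving u∉S) (moving v∉S)
      ; A-B-meet       = λ _ _ a b → lowered-raised-meet
          (λ { refl → proj₁ (∈B⁻ b) (∈A⁻ a) }) (∈A⁻ a) (proj₂ (∈B⁻ b))
      }
      where
      A B S : Subset n
      A = tabulate (does ∘ lowered?)
      B = tabulate (does ∘ onlyRaised?)
      S = tabulate (does ∘ fixed?)

      ∈A⁻ : ∀ {v} → v ∈ A → Lowered v
      ∈A⁻ = ∈-tabulate⁻ lowered?

      ∈B⁻ : ∀ {v} → v ∈ B → ¬ Lowered v × Raised v
      ∈B⁻ = ∈-tabulate⁻ onlyRaised?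

      ∈S⁻ : ∀ {v} → v ∈ S → ¬ Lowered v × ¬ Raised v
      ∈S⁻ = ∈-tabulate⁻ fixed?

      covered : ∀ v → v ∈ A ⊎ v ∈ B ∪ S
      covered v with lowered? v | raised? v
      ... | yes low | _        = inj₁ (∈-tabulate⁺ lowered? low)
      ... | no ¬low | yes high = inj₂ (p⊆p∪q S (∈-tabulate⁺ onlyRaised? (¬low , high)))
      ... | no ¬low | no ¬high = inj₂ (q⊆p∪q B S (∈-tabulate⁺ fixed? (¬low , ¬high)))

      moving : ∀ {v} → v ∉ S → ∃ λ c → Moves f c v
      moving {v} v∉S with lowered? v | raised? v
      ... | yes low | _        = _ , lowered⇒moves low
      ... | no _    | yes high = _ , raised⇒moves high
      ... | no ¬low | no ¬high = contradiction (∈-tabulate⁺ fixed? (¬low , ¬high)) v∉S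

-- From a near-biclique to an update function

module Sufficiency {D : Digraph n} (loopless : Loopless D) (K : NearBiclique D) where
  open NearBiclique K

  -- One formula covers the three kinds of vertex: outside `A` the implication is vacuous, and
  -- outside `B` the second alternative is impossible.
  Active : Config n → Pred (Fin n) 0ℓ
  Active x v = (v ∈ x × (v ∈ A → ∃[ u ] (Arc D u v × u ∈ x)))
             ⊎ (v ∈ B × (∀ u → Arc D u v → u ∈ x))

  active? : ∀ x → Decidable (Active x)
  active? x v =
    (v ∈? x ×-dec (v ∈? A →-dec Fin.any? λ u → arc? D u v ×-dec u ∈? x))
    ⊎-dec (v ∈? B ×-dec Fin.all? λ u → arc? D u v →-dec u ∈? x)

  f : Config n → Config n
  f x = tabulate (does ∘ active? x)

  ∈f⁺ : ∀ {x v} → Active x v → v ∈ f x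
  ∈f⁺ {x} = ∈-tabulate⁺ (active? x)

  ∈f⁻ : ∀ {x v} → v ∈ f x → Active x v
  ∈f⁻ {x} = ∈-tabulate⁻ (active? x)

  -- Comparing only at closed in-neighbours lets this serve twice: for the monotonicity of `f` and,
  -- applied in both directions, for the absence of arcs outside `D °`.
  active-mono : ∀ {x y v} → (∀ u → Arc (D °) u v → u ∈ x → u ∈ y) → Active x v → Active y v
  active-mono {v = v} x→y (inj₁ (v∈x , some)) =
    inj₁ (x→y v (inj₂ refl) v∈x , λ v∈A → let (u , uv , u∈x) = some v∈A
                               in u , uv , x→y u (inj₁ uv) u∈x)
  active-mono x→y (inj₂ (v∈B , all)) =
    inj₂ (v∈B , λ u uv → x→y u (inj₁ uv) (all u uv))

  A∩B⇒⊥ : ∀ {v} → v ∈ A → v ∉ B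
  A∩B⇒⊥ v∈A v∈B = A∩B-disjoint (_ , x∈p∩q⁺ (v∈A , v∈B))

  nonSource⇒arc : ∀ {v} → v ∉ S → ∃[ u ] Arc D u v
  nonSource⇒arc {v} v∉S = decidable-stable (Fin.any? λ u → arc? D u v) λ none →
    v∉S (from (S-sources v) λ (u , u∈N) → none (u , ∈N⁻ D u∈N))

  A⇒arc : ∀ {v} → v ∈ A → ∃[ u ] Arc D u v
  A⇒arc v∈A = nonSource⇒arc λ v∈S → A∩S-disjoint (_ , x∈p∩q⁺ (v∈A , v∈S))

  B⇒arc : ∀ {v} → v ∈ B → ∃[ u ] Arc D u v
  B⇒arc v∈B = nonSource⇒arc λ v∈S → B∩S-disjoint (_ , x∈p∩q⁺ (v∈B , v∈S))

  arc⇒A⊎B : ∀ {u v} → Arc D u v → v ∈ A ⊎ v ∈ B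
  arc⇒A⊎B {u} {v} uv with x∈p∪q⁻ A (B ∪ S) (subst (v ∈_) (sym cover) ∈⊤)
  ... | inj₁ v∈A = inj₁ v∈A
  ... | inj₂ v∈BS with x∈p∪q⁻ B S v∈BS
  ...   | inj₁ v∈B = inj₂ v∈B
  ...   | inj₂ v∈S = contradiction (u , ∈N⁺ D uv) (to (S-sources v) v∈S)

  G⁺ : ∀ {u v} x → Active (x [ u ]≔ true) v → ¬ Active (x [ u ]≔ false) v → G f u v
  G⁺ {u} {v} x act ¬act =
    x [ u ]≔ true , x [ u ]≔ false ,
    ( (λ eq → contradiction
        (trans (sym (lookup∘update u x true)) (trans eq (lookup∘update u x false))) λ ())
    , (λ w w≢u → trans (lookup∘update′ w≢u x true) (sym (lookup∘update′ w≢u x false))) ) ,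
    lookup-≢⁺ (∈f⁺ act) (¬act ∘ ∈f⁻)

  u∈x[u]≔true : ∀ u (x : Config n) → u ∈ x [ u ]≔ true
  u∈x[u]≔true u x = lookup⇒[]= u _ (lookup∘update u x true)

  u∉x[u]≔false : ∀ u (x : Config n) → u ∉ x [ u ]≔ false
  u∉x[u]≔false u x u∈ with trans (sym (lookup∘update u x false)) ([]=⇒lookup u∈)
  ... | ()

  ∈-update⁺ : ∀ {u w b} {x : Config n} → w ≢ u → w ∈ x → w ∈ x [ u ]≔ b
  ∈-update⁺ {b = b} {x} w≢u = ∈-resp-lookup (sym (lookup∘update′ w≢u x b))

  ∈-update⁻ : ∀ {u w b} {x : Config n} → w ≢ u → w ∈ x [ u ]≔ b → w ∈ x
  ∈-update⁻ {b = b} {x} w≢u = ∈-resp-lookup (lookup∘update′ w≢u x b)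

  arc⇒≢ : ∀ {u v} → Arc D u v → u ≢ v
  arc⇒≢ uv refl = loopless _ uv

  -- The background must leave the decision to coordinate `v`: with all ones, the disjunction over
  -- the in-neighbours of a vertex in `A` holds; with all zeros, the conjunction for a vertex in `B`
  -- fails, since it has an in-neighbour.
  loop⇒G : ∀ v → G f v v
  loop⇒G v with v ∈? B
  ... | no v∉B = G⁺ ⊤
    (inj₁ (u∈x[u]≔true v ⊤ , λ v∈A →
      let (u , uv) = A⇒arc v∈A in u , uv , ∈-update⁺ (arc⇒≢ uv) ∈⊤))
    λ { (inj₁ (v∈x , _)) → u∉x[u]≔false v ⊤ v∈x
      ; (inj₂ (v∈B , _)) → v∉B v∈B }
  ... | yes v∈B = G⁺ ⊥
    (inj₁ (u∈x[u]≔true v ⊥ , λ v∈A → contradiction v∈B (A∩B⇒⊥ v∈A)))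
    λ { (inj₁ (v∈x , _)) → u∉x[u]≔false v ⊥ v∈x
      ; (inj₂ (_ , all)) →
          let (u , uv) = B⇒arc v∈B in ∉⊥ (∈-update⁻ (arc⇒≢ uv) (all u uv)) }

  -- For `v` in `A`, the background `⁅ v ⁆` keeps `v` at 1 and all its other in-neighbours at 0, so
  -- `u` alone decides the disjunction. The background `∁ ⁅ v ⁆` is the dual choice for `B`.
  arc⇒G : ∀ {u v} → Arc D u v → G f u v
  arc⇒G {u} {v} uv with arc⇒A⊎B uv
  ... | inj₁ v∈A = G⁺ ⁅ v ⁆
    (inj₁ (∈-update⁺ (≢-sym (arc⇒≢ uv)) (x∈⁅x⁆ v) , λ _ → u , uv , u∈x[u]≔true u ⁅ v ⁆))
    λ { (inj₁ (_ , some)) → noneActive (some v∈A)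
      ; (inj₂ (v∈B , _)) → A∩B⇒⊥ v∈A v∈B }
    where
    noneActive : ¬ (∃[ w ] (Arc D w v × w ∈ ⁅ v ⁆ [ u ]≔ false))
    noneActive (w , wv , w∈) with w Fin.≟ u
    ... | yes refl = u∉x[u]≔false u ⁅ v ⁆ w∈
    ... | no w≢u   = arc⇒≢ wv (x∈⁅y⁆⇒x≡y v (∈-update⁻ w≢u w∈))
  ... | inj₂ v∈B = G⁺ (∁ ⁅ v ⁆)
    (inj₂ (v∈B , allActive))
    λ { (inj₁ (v∈x , _)) → x∈∁⁅y⁆⁻ (∈-update⁻ (≢-sym (arc⇒≢ uv)) v∈x) refl
      ; (inj₂ (_ , all)) → u∉x[u]≔false u (∁ ⁅ v ⁆) (all u uv) }
    where
    allActive : ∀ w → Arc D w v → w ∈ (∁ ⁅ v ⁆) [ u ]≔ true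
    allActive w wv with w Fin.≟ u
    ... | yes refl = u∈x[u]≔true u (∁ ⁅ v ⁆)
    ... | no w≢u   = ∈-update⁺ w≢u (x∈∁⁅y⁆⁺ (arc⇒≢ wv))

  G⇒arc : ∀ {u v} → G f u v → Arc (D °) u v
  G⇒arc {u} {v} (x , y , (_ , agree) , ne) = decidable-stable (arc? (D °) u v) λ ¬uv →
    let eq : ∀ w → Arc (D °) w v → lookup x w ≡ lookup y w
        eq w wv = agree w λ { refl → ¬uv wv }
    in ne (lookup-≡⁺
         (λ v∈ → ∈f⁺ (active-mono (λ w wv → ∈-resp-lookup (eq w wv)) (∈f⁻ {x} v∈)))
         (λ v∈ → ∈f⁺ (active-mono (λ w wv → ∈-resp-lookup (sym (eq w wv))) (∈f⁻ {y} v∈))))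

  f∈F₊ : F₊ (D °) f
  f∈F₊ = (λ u v → mk⇔ G⇒arc [ arc⇒G , (λ { refl → loop⇒G u }) ]′)
       , λ x≤y → ⊆⇒≤ᶜ λ v∈ → ∈f⁺ (active-mono (λ u _ → ≤ᶜ⇒⊆ x≤y) (∈f⁻ v∈))

  moves⁻ : ∀ {x v} → Moves f x v →
           (v ∈ A × v ∈ x × (∀ u → Arc D u v → u ∉ x))
           ⊎ (v ∈ B × v ∉ x × (∀ u → Arc D u v → u ∈ x))
  moves⁻ {x} {v} xv with lookup-≢⁻ xv
  ... | inj₁ (v∈x , v∉fx) = inj₁
    ( decidable-stable (v ∈? A) (λ v∉A →
        v∉fx (∈f⁺ (inj₁ (v∈x , λ v∈A → contradiction v∈A v∉A))))
    , v∈x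
    , λ u uv u∈x → v∉fx (∈f⁺ (inj₁ (v∈x , λ _ → u , uv , u∈x))) )
  ... | inj₂ (v∉x , v∈fx) with ∈f⁻ v∈fx
  ...   | inj₁ (v∈x , _)   = contradiction v∈x v∉x
  ...   | inj₂ (v∈B , all) = inj₂ (v∈B , v∉x , all)

  -- Two moving vertices of `A` both have value 1 while all their in-neighbours have value 0, which
  -- an arc between them forbids; `B` is dual. For one vertex of each kind, a common in-neighbour
  -- would have both values.
  atMostOneMoves : AtMostOneMoves f
  atMostOneMoves x u v xu xv = decidable-stable (u Fin.≟ v) λ u≢v →
    clash u≢v (moves⁻ xu) (moves⁻ xv)
    where
    meet-clash : ∀ {a b} → a ∈ A → b ∈ B →
                 (∀ w → Arc D w a → w ∉ x) → ¬ (∀ w → Arc D w b → w ∈ x)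
    meet-clash a∈A b∈B none all =
      let (w , w∈) = A-B-meet _ _ a∈A b∈B
          (wa , wb) = x∈p∩q⁻ (N D _) (N D _) w∈
      in none w (∈N⁻ D wa) (all w (∈N⁻ D wb))

    clash : u ≢ v → _ → ¬ _
    clash u≢v (inj₁ (u∈A , u∈x , noneᵤ)) (inj₁ (v∈A , v∈x , noneᵥ)) =
      [ (λ uv → noneᵥ u uv u∈x) , (λ vu → noneᵤ v vu v∈x) ]′ (A-semicomplete u v u∈A v∈A u≢v)
    clash u≢v (inj₂ (u∈B , u∉x , allᵤ)) (inj₂ (v∈B , v∉x , allᵥ)) =
      [ (λ uv → u∉x (allᵥ u uv)) , (λ vu → v∉x (allᵤ v vu)) ]′ (B-semicomplete u v u∈B v∈B u≢v)
    clash u≢v (inj₁ (u∈A , _ , none)) (inj₂ (v∈B , _ , all)) = meet-clash u∈A v∈B none all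
    clash u≢v (inj₂ (u∈B , _ , all)) (inj₁ (v∈A , _ , none)) = meet-clash v∈A u∈B none all

-- The upper bound given by an arc, and the equivalence

G-nonloop⇒moves : ∀ {f : Config n → Config n} {u v} → u ≢ v → G f u v → ∃ λ x → Moves f x v
G-nonloop⇒moves {f = f} {u} {v} u≢v (x , y , (_ , agree) , ne) with lookup x v Bool.≟ lookup (f x) v
... | no xv = x , xv
-- If `v` were fixed at `y` too, the outputs at `v` would coincide, since `x` and `y` agree away
-- from `u`.
... | yes eq = y , λ eq′ → ne (trans (sym eq) (trans (agree v (≢-sym u≢v)) eq′))

-- The head of an arc of `D` depends on another vertex, so it moves somewhere. As this holds for
-- every `f`, it bounds both the constructed function and all its competitors.
hasArc⇒s≤n∸1 : ∀ (D : Digraph n) → Loopless D → HasArc D → ∀ f → F₊ (D °) f → s f ≤ n ∸ 1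
hasArc⇒s≤n∸1 D loopless (u , v , uv) f (G⇔ , _) =
  s≤n∸1⁺ f (proj₂ (G-nonloop⇒moves {f = f} (λ { refl → loopless u uv }) (from (G⇔ u v) (inj₁ uv))))

theorem3p13 : ∀ (n : ℕ) .{{_ : NonZero n}} (D : Digraph n) → Loopless D →
    (s₊[ D ° ]= (n ∸ 1)) ⇔ (HasArc D × NearBiclique D)
theorem3p13 n D loopless = mk⇔ necessary sufficient
  where
  necessary : s₊[ D ° ]= (n ∸ 1) → HasArc D × NearBiclique D
  necessary ((f , f∈F₊ , s≡) , _) =
    hasArc s≡ , nearBiclique (n∸1≤s⁻ f (ℕ.≤-reflexive (sym s≡)))
    where open Necessity loopless f∈F₊

  sufficient : HasArc D × NearBiclique D → s₊[ D ° ]= (n ∸ 1)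
  sufficient (arc , K) =
    (f , f∈F₊ , ℕ.≤-antisym (upper f f∈F₊) (n∸1≤s⁺ f atMostOneMoves)) , upper
    where
    open Sufficiency loopless K
    upper = hasArc⇒s≤n∸1 D loopless arc
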